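{- Let $v\ge2$ be an integer with $\gcd(v,4)\ne2$ and $\gcd(v,18)\ne3$. Then an optimum $(d,2)$-CDA$((d+1)v^2;11,v)$ exists for every positive integer $d$ with $d+1\le v$.
   Context: Consecutive $t$-way interaction in an $N\times k$ array $A=(a_{ij})$ over a $v$-set $V$: $T=\{(i,x_i),\dots,(i+t-1,x_{i+t-1})\}$, $1\le i\le k-t+1$, $x_r\in V$; $\rho(A,T)=\{r: a_{r,j}=x_j\ \forall (j,x_j)\in T\}$, $\rho(A,\mathcal T)=\bigcup_{T\in\mathcal T}\rho(A,T)$. A $(d,t)$-CDA$(N;k,v)$ is an $N\times k$ array over $V$ in which every $t$ consecutive columns contain every $t$-tuple at least once, and such that for every set $\mathcal T$ of exactly $d$ distinct consecutive $t$-way interactions and every consecutive $t$-way interaction $T$: $\rho(A,T)\subseteq\rho(A,\mathcal T)$ iff $T\in\mathcal T$. It is optimum if $N=(d+1)v^t$. -}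

module Defs where

open import Data.Fin using (Fin; toℕ; fromℕ<)
open import Data.Fin.Properties using (toℕ<n)
open import Data.List using (List; length)
open import Data.List.Membership.Propositional using (_∈_)
open import Data.List.Relation.Unary.Unique.Propositional using (Unique)
open import Data.Nat using (ℕ; suc; _+_; _*_; _^_; _∸_; _≤_; _<_; s≤s⁻¹)
open import Data.Nat.Properties using (module ≤-Reasoning; +-monoʳ-≤; +-suc; m≤o∸n⇒m+n≤o; m∸n≢0⇒n<m; m<n⇒n≢0; <⇒≤)
open import Data.Product using (_×_; ∃-syntax)
open import Data.Vec using (Vec; lookup)
open import Function.Bundles using (_⇔_)
open import Level using (0ℓ)
open import Relation.Binary.PropositionalEquality using (_≡_)
open import Relation.Unary using (Pred; _⊆_; Satisfiable)

Array : (N k v : ℕ) → Set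
Array N k v = Fin N → Fin k → Fin v

start+offset<k : ∀ {t k i s} → i < suc k ∸ t → s < t → i + s < k
start+offset<k {t} {k} {i} {s} i<1+k∸t s<t = s≤s⁻¹ (begin
  suc (suc (i + s))  ≡⟨ +-suc (suc i) s ⟨
  suc i + suc s      ≤⟨ +-monoʳ-≤ (suc i) s<t ⟩
  suc i + t          ≤⟨ m≤o∸n⇒m+n≤o (suc i) t≤1+k i<1+k∸t ⟩
  suc k              ∎)
  where
  open ≤-Reasoning
  t≤1+k : t ≤ suc k
  t≤1+k = <⇒≤ (m∸n≢0⇒n<m (m<n⇒n≢0 i<1+k∸t))

-- The interaction {(i , x_i) , … , (i+t-1 , x_{i+t-1})}, determined by i and
-- the tuple of values. Columns are numbered from 0, so i ranges over the
-- k - t + 1 numbers 0, …, k - t (and over nothing if t > k).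
record Interaction (t k v : ℕ) : Set where
  constructor interaction
  field
    start  : Fin (suc k ∸ t)
    values : Vec (Fin v) t

  column : Fin t → Fin k
  column s = fromℕ< (start+offset<k {t} (toℕ<n start) (toℕ<n s))

module _ {N t k v : ℕ} (A : Array N k v) where

  ρ : Interaction t k v → Pred (Fin N) 0ℓ
  ρ T r = ∀ s → A r (column s) ≡ lookup values s
    where open Interaction T

  ρ⋃ : List (Interaction t k v) → Pred (Fin N) 0ℓ
  ρ⋃ 𝒯 r = ∃[ T ] T ∈ 𝒯 × ρ T r

-- A (d,t)-CDA(N;k,v) over the v-set Fin v. A set of exactly d distinct
-- interactions is a duplicate-free list of length d.
record CDA (d t N k v : ℕ) : Set where
  field
    array     : Array N k v
    covering  : (T : Interaction t k v) → Satisfiable (ρ array T)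
    detecting : (𝒯 : List (Interaction t k v)) → Unique 𝒯 → length 𝒯 ≡ d →
                (T : Interaction t k v) →
                (ρ array T ⊆ ρ⋃ array 𝒯) ⇔ (T ∈ 𝒯)

Optimum : ∀ {d t N k v} → CDA d t N k v → Set
Optimum {d} {t} {N} {k} {v} _ = N ≡ (d + 1) * v ^ t

{-# OPTIONS --safe #-}

-- Let an orthogonal array OA(3,6,v) be given. Keep the rows whose entry in
-- column 0 takes one of d + 1 prescribed values, and read the other five columns
-- along an Eulerian circuit of K₅, which has 10 edges and hence visits 11 columns.
-- Two consecutive columns together with column 0 are independent, so every
-- interaction is covered by exactly d + 1 rows, one for each prescribed value.
-- Two interactions at different places involve at least three different columns
-- and so share at most one row; hence d interactions never cover another one.
--
-- An OA(3,6,v) comes from functions on an abelian group of order v, all of whose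
-- relevant sums and differences are bijective. Multiplications by small integers
-- do this in ℤ/v if v is prime to 6, field multiplications do it in orders
-- 4, 8, 9 and 27, and tables found by computer search in orders 12 and 24. The
-- gcd conditions say precisely that v is a product of such orders.
module Submission where

open import Defs
open import Algebra.Bundles using (AbelianGroup)
import Algebra.Construct.DirectProduct as DirectProduct
import Algebra.Properties.AbelianGroup as AbelianGroupProperties
import Algebra.Properties.CommutativeSemigroup as CommutativeSemigroupProperties
open import Data.Fin as Fin using (Fin; toℕ; fromℕ<; inject≤; combine; remQuot; punchOut)
open import Data.Fin.Patterns using (0F; 1F; 2F; 3F; 4F; 5F)
open import Data.Fin.Properties using (_≟_; toℕ<n; toℕ-injective; toℕ-fromℕ<; all?; any?; pigeonhole; injective⇒≤; punchOut-injective; combine-injective; remQuot-combine; combine-remQuot; inject≤-injective; *↔×; <⇒≢)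
open import Data.Integer as ℤ using (ℤ; +_; 0ℤ)
open import Data.Integer.Coprimality using () renaming (coprime-divisor to ℤ-coprime-divisor)
open import Data.Integer.DivMod using (_%ℕ_; _/ℕ_; a≡a%ℕn+[a/ℕn]*n; n%ℕd<d)
open import Data.Integer.Divisibility.Signed as ℤ using (∣m∣n⇒∣m+n; ∣m⇒∣-m; ∣⇒∣ᵤ; ∣ᵤ⇒∣)
import Data.Integer.Properties as ℤ
open import Data.Integer.Tactic.RingSolver using (solve-∀)
open import Data.List as List using (List; []; _∷_; length)
import Data.List.Membership.DecPropositional as DecMembership
open import Data.List.Membership.Propositional using (_∈_)
open import Data.List.Relation.Unary.Any using (here; there; index)
open import Data.List.Relation.Unary.Any.Properties using (lookup-index)
open import Data.Nat using (ℕ; suc; _+_; _*_; _^_; _≤_; _<_; _⊔_; s≤s; z≤n; _≤?_; NonZero; NonTrivial; >-nonZero)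
open import Data.Nat.Coprimality using (Coprime; coprime⇒gcd≡1; coprime-divisor)
open import Data.Nat.DivMod using (_mod_)
open import Data.Nat.Divisibility using (_∣_; _∤_; _∣?_; divides; divides-refl; >⇒∤; 0∣⇒≡0; ∣⇒≤; ∣-trans; ∣n⇒∣m*n; quotient-<; quotient≢0)
open import Data.Nat.GCD using (gcd; c*gcd[m,n]≡gcd[cm,cn])
open import Data.Nat.Induction using (<-rec)
open import Data.Nat.Properties using (n≮n; ≤-reflexive; ≤-trans; ≤-<-trans; +-comm; *-comm; *-assoc; *-identityˡ; *-identityʳ; m≤n+m; m*n≢0⇒n≢0; ^-distribˡ-+-*; ⊔-pres-<m)
open import Data.Product using (Σ; ∃-syntax; _×_; _,_; proj₁; proj₂; map; map₂)
open import Data.Product.Function.NonDependent.Propositional using (_×-↔_)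
open import Data.Product.Properties using (,-injective; ,-injectiveˡ; ,-injectiveʳ)
open import Data.Sum using (_⊎_; inj₁; inj₂)
open import Data.Vec using (Vec; []; _∷_; lookup)
open import Data.Vec.Properties using (≡-dec; tabulate∘lookup; tabulate-cong)
open import Function using (_∘_; Injective; _↔_; Inverse; mk⇔)
open import Function.Construct.Composition using (_↔-∘_)
open import Function.Construct.Identity using (↔-id)
open import Level using (0ℓ)
open import Relation.Binary.Definitions using (DecidableEquality)
open import Relation.Binary.PropositionalEquality using (_≡_; _≢_; refl; sym; trans; cong; cong₂; subst)
open import Relation.Nullary using (Dec; yes; no; contradiction; ¬?)
open import Relation.Nullary.Decidable using (from-yes; True; toWitness; map′; _×-dec_; _→-dec_; _⊎-dec_)

-- Injective self-maps of finite sets.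

injective⇒surjective : ∀ {n} {f : Fin n → Fin n} → Injective _≡_ _≡_ f → ∀ y → ∃[ x ] f x ≡ y
injective⇒surjective {suc n} {f} f-inj y with any? (λ x → f x ≟ y)
... | yes hit  = hit
-- Removing the missed value `y` from the codomain would inject `suc n` elements into `n`.
... | no  miss = contradiction (injective⇒≤ punched-inj) (n≮n n)
  where
  y≢f : ∀ x → y ≢ f x
  y≢f x y≡fx = miss (x , sym y≡fx)

  punched-inj : Injective _≡_ _≡_ (λ x → punchOut (y≢f x))
  punched-inj eq = f-inj (punchOut-injective (y≢f _) (y≢f _) eq)

abstract
  ↔-injective⇒surjective : ∀ {n} {A : Set} → Fin n ↔ A → {f : A → A} → Injective _≡_ _≡_ f → ∀ y → ∃[ x ] f x ≡ y
  ↔-injective⇒surjective e {f} f-inj y = map to from-injective (injective⇒surjective inj (from y))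
    where
    open Inverse e using (to; from; strictlyInverseˡ; strictlyInverseʳ)

    from-injective : ∀ {i} → from (f (to i)) ≡ from y → f (to i) ≡ y
    from-injective eq = trans (sym (strictlyInverseˡ _)) (trans (cong to eq) (strictlyInverseˡ y))

    inj : Injective _≡_ _≡_ (from ∘ f ∘ to)
    inj {i} {j} eq = trans (sym (strictlyInverseʳ i)) (trans (cong from (f-inj
      (trans (sym (strictlyInverseˡ _)) (trans (cong to eq) (strictlyInverseˡ _))))) (strictlyInverseʳ j))

-- Orthogonal arrays of strength 3 and their products.

Triple : ℕ → Set
Triple v = Fin v × Fin v × Fin v

triples : ∀ v → Fin (v * (v * v)) ↔ Triple v
triples v = (↔-id (Fin v) ×-↔ *↔×) ↔-∘ *↔×

-- An OA(3,k,v), with its v³ rows indexed by triples; by counting, it is enough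
-- that rows agreeing in three columns coincide.
record OrthogonalArray (k v : ℕ) : Set where
  field
    entry    : Triple v → Fin k → Fin v
    separate : ∀ {p q r} → p ≢ q → p ≢ r → q ≢ r → ∀ {R S} →
               entry R p ≡ entry S p → entry R q ≡ entry S q → entry R r ≡ entry S r → R ≡ S

  abstract
    occurs : ∀ {p q r} → p ≢ q → p ≢ r → q ≢ r → ∀ a b c →
             ∃[ R ] entry R p ≡ a × entry R q ≡ b × entry R r ≡ c
    occurs p≢q p≢r q≢r a b c = map₂ (λ eq → ,-injectiveˡ eq , ,-injective (,-injectiveʳ eq))
      (↔-injective⇒surjective (triples v) {λ R → entry R _ , entry R _ , entry R _}
        (λ eq → let eq₂ , eq₃ = ,-injective (,-injectiveʳ eq) in separate p≢q p≢r q≢r (,-injectiveˡ eq) eq₂ eq₃)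
        (a , b , c))

_⊠_ : ∀ {k v w} → OrthogonalArray k v → OrthogonalArray k w → OrthogonalArray k (v * w)
_⊠_ {k} {v} {w} A B = record
  { entry    = λ R c → combine (A.entry (left R) c) (B.entry (right R) c)
  ; separate = λ p≢q p≢r q≢r {R} {S} p≡ q≡ r≡ →
      let pA , pB = combine-injective _ _ _ _ p≡
          qA , qB = combine-injective _ _ _ _ q≡
          rA , rB = combine-injective _ _ _ _ r≡
      in left-right-injective R S (A.separate p≢q p≢r q≢r pA qA rA) (B.separate p≢q p≢r q≢r pB qB rB)
  }
  where
  module A = OrthogonalArray A
  module B = OrthogonalArray B

  left : Triple (v * w) → Triple v
  left (x , y , z) = proj₁ (remQuot w x) , proj₁ (remQuot w y) , proj₁ (remQuot w z)

  right : Triple (v * w) → Triple w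
  right (x , y , z) = proj₂ (remQuot {v} w x) , proj₂ (remQuot {v} w y) , proj₂ (remQuot {v} w z)

  remQuot-injective : ∀ {x y : Fin (v * w)} → proj₁ (remQuot {v} w x) ≡ proj₁ (remQuot {v} w y) →
                      proj₂ (remQuot {v} w x) ≡ proj₂ (remQuot {v} w y) → x ≡ y
  remQuot-injective {x} {y} eq₁ eq₂ =
    trans (sym (combine-remQuot {v} w x)) (trans (cong₂ combine eq₁ eq₂) (combine-remQuot {v} w y))

  left-right-injective : ∀ R S → left R ≡ left S → right R ≡ right S → R ≡ S
  left-right-injective R S l≡ r≡ =
    cong₂ _,_ (remQuot-injective (,-injectiveˡ l≡) (,-injectiveˡ r≡))
      (cong₂ _,_ (remQuot-injective (,-injectiveˡ (,-injectiveʳ l≡)) (,-injectiveˡ (,-injectiveʳ r≡)))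
                 (remQuot-injective (,-injectiveʳ (,-injectiveʳ l≡)) (,-injectiveʳ (,-injectiveʳ r≡))))

-- From an orthogonal array to a detecting array.

-- An Eulerian circuit of the complete graph on the columns 1, …, 5.
circuit : Vec (Fin 6) 11
circuit = 1F ∷ 2F ∷ 3F ∷ 4F ∷ 5F ∷ 1F ∷ 3F ∷ 5F ∷ 2F ∷ 4F ∷ 1F ∷ []

edge : Fin 10 → Fin 2 → Fin 6
edge i s = lookup circuit (fromℕ< (start+offset<k {2} {11} (toℕ<n i) (toℕ<n s)))

abstract
  edge≢0 : ∀ i s → 0F ≢ edge i s
  edge≢0 = from-yes (all? λ i → all? λ s → ¬? (0F ≟ edge i s))

  edge-ends-differ : ∀ i → edge i 0F ≢ edge i 1F
  edge-ends-differ = from-yes (all? λ i → ¬? (edge i 0F ≟ edge i 1F))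

  -- The circuit uses no edge of K₅ twice, so of two edges at different places the second has an end
  -- off the first. That end and the two ends of the first give the three columns which pin down a
  -- row.
  edges-differ : ∀ i j → i ≢ j → ∃[ s ] edge i 0F ≢ edge j s × edge i 1F ≢ edge j s
  edges-differ = from-yes (all? λ i → all? λ j → ¬? (i ≟ j) →-dec
    any? λ s → ¬? (edge i 0F ≟ edge j s) ×-dec ¬? (edge i 1F ≟ edge j s))

_≟ᴵ_ : ∀ {t k v} → DecidableEquality (Interaction t k v)
interaction i xs ≟ᴵ interaction j ys =
  map′ (λ (i≡j , xs≡ys) → cong₂ interaction i≡j xs≡ys) (λ { refl → refl , refl }) ((i ≟ j) ×-dec ≡-dec _≟_ xs ys)

module FromOrthogonalArray {v} (O : OrthogonalArray 6 v) {d} (d+1≤v : d + 1 ≤ v) where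
  open OrthogonalArray O

  indices : Fin ((d + 1) * v ^ 2) ↔ (Fin (d + 1) × (Fin v × Fin v))
  indices = (↔-id (Fin (d + 1)) ×-↔ pairs) ↔-∘ *↔×
    where
    pairs : Fin (v ^ 2) ↔ (Fin v × Fin v)
    -- `v ^ 2` unfolds to `v * (v * 1)`; the trailing factor 1 has to be removed.
    pairs = subst (λ n → Fin n ↔ (Fin v × Fin v)) (cong (v *_) (sym (*-identityʳ v))) *↔×

  level : Fin (d + 1) → Fin v
  level s = inject≤ s d+1≤v

  rowWith : ∀ a b c → ∃[ R ] entry R 0F ≡ a × entry R 1F ≡ b × entry R 2F ≡ c
  rowWith = occurs (λ ()) (λ ()) (λ ())

  selected : Fin (d + 1) × (Fin v × Fin v) → Triple v
  selected (s , b , c) = proj₁ (rowWith (level s) b c)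

  -- Columns 0, 1 and 2 determine a row, so the row chosen for these entries is `R` itself. Hence no
  -- row with a prescribed level is lost.
  selected-surjective : ∀ R s → entry R 0F ≡ level s → selected (s , entry R 1F , entry R 2F) ≡ R
  selected-surjective R s R₀≡s with _ , S₀ , S₁ , S₂ ← rowWith (level s) (entry R 1F) (entry R 2F) =
    separate (λ ()) (λ ()) (λ ()) (trans S₀ (sym R₀≡s)) S₁ S₂

  abstract
    row : Fin ((d + 1) * v ^ 2) → Triple v
    row r = selected (Inverse.to indices r)

    row-surjective : ∀ R s → entry R 0F ≡ level s → ∃[ r ] row r ≡ R
    row-surjective R s R₀≡s = Inverse.from indices (s , entry R 1F , entry R 2F) ,
      trans (cong selected (Inverse.strictlyInverseˡ indices _)) (selected-surjective R s R₀≡s)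

  array : Array ((d + 1) * v ^ 2) 11 v
  array r c = entry (row r) (lookup circuit c)

  abstract
    -- Column 0 and the ends of the edge are three distinct columns, so strength 3 supplies a row
    -- for each level.
    ρ-row : ∀ (T : Interaction 2 11 v) s → ∃[ r ] ρ array T r × entry (row r) 0F ≡ level s
    ρ-row (interaction i (x ∷ y ∷ [])) s
      with R , R₀ , R₁ , R₂ ← occurs (edge≢0 i 0F) (edge≢0 i 1F) (edge-ends-differ i) (level s) x y
      with r , refl ← row-surjective R s R₀
      = r , (λ { 0F → R₁ ; 1F → R₂ }) , R₀

  -- At the same place, a common row would force equal values. At different places, `edges-differ`
  -- gives three columns in which both rows agree.
  ρ∩ρ-row-unique : ∀ {T U : Interaction 2 11 v} → T ≢ U → ∀ {r r′} →
                   ρ array T r → ρ array U r → ρ array T r′ → ρ array U r′ → row r ≡ row r′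
  ρ∩ρ-row-unique {interaction i xs} {interaction j ys} T≢U rT rU r′T r′U with i ≟ j
  ... | yes refl = contradiction (cong (interaction i) (lookup-injective λ s → trans (sym (rT s)) (rU s))) T≢U
    where
    lookup-injective : (∀ s → lookup xs s ≡ lookup ys s) → xs ≡ ys
    lookup-injective eq = trans (sym (tabulate∘lookup xs)) (trans (tabulate-cong eq) (tabulate∘lookup ys))
  ... | no i≢j with s , i₀≢ , i₁≢ ← edges-differ i j i≢j =
    separate (edge-ends-differ i) i₀≢ i₁≢
      (trans (rT 0F) (sym (r′T 0F))) (trans (rT 1F) (sym (r′T 1F))) (trans (rU s) (sym (r′U s)))

  -- If `T` were missing from `𝒯`, its d + 1 rows, one per level, would be covered by d
  -- interactions. By pigeonhole two of them lie in the same `U ≢ T` and therefore coincide,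
  -- although their levels differ.
  ρ⊆ρ⋃⇒∈ : ∀ (𝒯 : List (Interaction 2 11 v)) → length 𝒯 ≡ d →
           ∀ T → (∀ {r} → ρ array T r → ρ⋃ array 𝒯 r) → T ∈ 𝒯
  ρ⊆ρ⋃⇒∈ 𝒯 |𝒯|≡d T ρT⊆ with DecMembership._∈?_ _≟ᴵ_ T 𝒯
  ... | yes T∈𝒯 = T∈𝒯
  ... | no  T∉𝒯 = contradiction s≡s′ (<⇒≢ s<s′)
    where
    r : Fin (d + 1) → Fin ((d + 1) * v ^ 2)
    r s = proj₁ (ρ-row T s)

    cover : ∀ s → ρ⋃ array 𝒯 (r s)
    cover s = ρT⊆ (proj₁ (proj₂ (ρ-row T s)))

    position : Fin (d + 1) → Fin (length 𝒯)
    position s = index (proj₁ (proj₂ (cover s)))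

    abstract
      collision : ∃[ s ] ∃[ s′ ] s Fin.< s′ × position s ≡ position s′
      collision = pigeonhole (≤-reflexive (trans (cong suc |𝒯|≡d) (+-comm 1 d))) position

    s    = proj₁ collision
    s′   = proj₁ (proj₂ collision)
    s<s′ = proj₁ (proj₂ (proj₂ collision))
    U    = proj₁ (cover s)

    U≡U′ : U ≡ proj₁ (cover s′)
    U≡U′ = trans (lookup-index (proj₁ (proj₂ (cover s))))
      (trans (cong (List.lookup 𝒯) (proj₂ (proj₂ (proj₂ collision)))) (sym (lookup-index (proj₁ (proj₂ (cover s′))))))

    T≢U : T ≢ U
    T≢U T≡U = T∉𝒯 (subst (_∈ 𝒯) (sym T≡U) (proj₁ (proj₂ (cover s))))

    same-row : row (r s) ≡ row (r s′)
    same-row = ρ∩ρ-row-unique {T} {U} T≢U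
      (proj₁ (proj₂ (ρ-row T s))) (proj₂ (proj₂ (cover s)))
      (proj₁ (proj₂ (ρ-row T s′))) (subst (λ V → ρ array V (r s′)) (sym U≡U′) (proj₂ (proj₂ (cover s′))))

    s≡s′ : s ≡ s′
    s≡s′ = inject≤-injective d+1≤v d+1≤v s s′
      (trans (sym (proj₂ (proj₂ (ρ-row T s)))) (trans (cong (λ R → entry R 0F) same-row) (proj₂ (proj₂ (ρ-row T s′)))))

  cda : CDA d 2 ((d + 1) * v ^ 2) 11 v
  cda = record
    { array     = array
    -- Level 0 exists because d + 1 is positive.
    ; covering  = λ T → let r , r∈ρT , _ = ρ-row T (fromℕ< (≤-trans (s≤s z≤n) (m≤n+m 1 d))) in r , r∈ρT
    ; detecting = λ 𝒯 _ |𝒯|≡d T → mk⇔ (ρ⊆ρ⋃⇒∈ 𝒯 |𝒯|≡d T) (λ T∈𝒯 r∈ρT → T , T∈𝒯 , r∈ρT)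
    }

-- Finite abelian groups: cyclic groups and direct products.

record FiniteAbelianGroup (n : ℕ) : Set₁ where
  field
    abelianGroup : AbelianGroup 0ℓ 0ℓ
  open AbelianGroup abelianGroup public
  field
    -- Carriers are setoids (integers under congruence, for cyclic groups), so finiteness is
    -- expressed by maps injective up to `≈`: `decode` turns row indices into elements, `encode`
    -- turns elements into array entries.
    encode           : Carrier → Fin n
    encode-cong      : ∀ {x y} → x ≈ y → encode x ≡ encode y
    encode-injective : ∀ {x y} → encode x ≡ encode y → x ≈ y
    decode           : Fin n → Carrier
    decode-injective : ∀ {i j} → decode i ≈ decode j → i ≡ j

module _ (n : ℕ) .{{_ : NonZero n}} where

  private
    _≋_ : ℤ → ℤ → Set
    x ≋ y = + n ℤ.∣ x ℤ.- y

    ≋-reflexive : ∀ {x y} → x ≡ y → x ≋ y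
    ≋-reflexive {x} refl = ℤ.divides 0ℤ (ℤ.+-inverseʳ x)

    ≋-sym : ∀ {x y} → x ≋ y → y ≋ x
    ≋-sym {x} {y} x≋y = subst (+ n ℤ.∣_) (lemma x y) (∣m⇒∣-m x≋y)
      where
      lemma : ∀ x y → ℤ.- (x ℤ.- y) ≡ y ℤ.- x
      lemma = solve-∀

    ≋-trans : ∀ {x y z} → x ≋ y → y ≋ z → x ≋ z
    ≋-trans {x} {y} {z} x≋y y≋z = subst (+ n ℤ.∣_) (lemma x y z) (∣m∣n⇒∣m+n x≋y y≋z)
      where
      lemma : ∀ x y z → (x ℤ.- y) ℤ.+ (y ℤ.- z) ≡ x ℤ.- z
      lemma = solve-∀

    +-cong : ∀ {x y u v} → x ≋ y → u ≋ v → (x ℤ.+ u) ≋ (y ℤ.+ v)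
    +-cong {x} {y} {u} {v} x≋y u≋v = subst (+ n ℤ.∣_) (lemma x y u v) (∣m∣n⇒∣m+n x≋y u≋v)
      where
      lemma : ∀ x y u v → (x ℤ.- y) ℤ.+ (u ℤ.- v) ≡ (x ℤ.+ u) ℤ.- (y ℤ.+ v)
      lemma = solve-∀

    neg-cong : ∀ {x y} → x ≋ y → (ℤ.- x) ≋ (ℤ.- y)
    neg-cong {x} {y} x≋y = subst (+ n ℤ.∣_) (lemma x y) (∣m⇒∣-m x≋y)
      where
      lemma : ∀ x y → ℤ.- (x ℤ.- y) ≡ (ℤ.- x) ℤ.- (ℤ.- y)
      lemma = solve-∀

    residue : ∀ x → (+ (x %ℕ n)) ≋ x
    residue x = ≋-sym {x} (ℤ.divides (x /ℕ n)
      (trans (cong (ℤ._- + (x %ℕ n)) (a≡a%ℕn+[a/ℕn]*n x n)) (lemma (+ (x %ℕ n)) (x /ℕ n ℤ.* + n))))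
      where
      lemma : ∀ r y → (r ℤ.+ y) ℤ.- r ≡ y
      lemma = solve-∀

    residueClass : ℤ → Fin n
    residueClass x = fromℕ< (n%ℕd<d x n)

    residueClass-≋ : ∀ x → (+ toℕ (residueClass x)) ≋ x
    residueClass-≋ x = subst (λ r → (+ r) ≋ x) (sym (toℕ-fromℕ< (n%ℕd<d x n))) (residue x)

    -- |i - j| ≤ max(i, j) < n, and 0 is the only multiple of n that small.
    toℕ-≋-injective : ∀ {i j : Fin n} → (+ toℕ i) ≋ (+ toℕ j) → i ≡ j
    toℕ-≋-injective {i} {j} i≋j =
      toℕ-injective (ℤ.+-injective (ℤ.i-j≡0⇒i≡j _ _ (ℤ.∣i∣≡0⇒i≡0 (small ∣i-j∣<n (∣⇒∣ᵤ i≋j)))))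
      where
      small : ∀ {m} → m < n → n ∣ m → m ≡ 0
      small {ℕ.zero} _   _   = refl
      small {suc _}  m<n n∣m = contradiction n∣m (>⇒∤ m<n)

      ∣i-j∣<n : ℤ.∣ + toℕ i ℤ.- + toℕ j ∣ < n
      ∣i-j∣<n = ≤-<-trans
        (subst (λ z → ℤ.∣ z ∣ ≤ toℕ i ⊔ toℕ j) (sym (ℤ.m-n≡m⊖n (toℕ i) (toℕ j))) (ℤ.∣m⊝n∣≤m⊔n (toℕ i) (toℕ j)))
        (⊔-pres-<m (toℕ<n i) (toℕ<n j))

  cyclic : FiniteAbelianGroup n
  cyclic = record
    { abelianGroup = record
      { Carrier = ℤ
      ; _≈_ = _≋_
      ; _∙_ = ℤ._+_
      ; ε = 0ℤ
      ; _⁻¹ = ℤ.-_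
      ; isAbelianGroup = record
        { isGroup = record
          { isMonoid = record
            { isSemigroup = record
              { isMagma = record
                { isEquivalence = record
                  { refl  = λ {x} → ≋-reflexive {x} refl
                  ; sym   = λ {x} → ≋-sym {x}
                  ; trans = λ {x} → ≋-trans {x}
                  }
                ; ∙-cong = λ {x} → +-cong {x}
                }
              ; assoc = λ x y z → ≋-reflexive (ℤ.+-assoc x y z)
              }
            ; identity = (≋-reflexive ∘ ℤ.+-identityˡ) , (≋-reflexive ∘ ℤ.+-identityʳ)
            }
          ; inverse = (≋-reflexive ∘ ℤ.+-inverseˡ) , (≋-reflexive ∘ ℤ.+-inverseʳ)
          ; ⁻¹-cong = λ {x} → neg-cong {x}
          }
        ; comm = λ x y → ≋-reflexive (ℤ.+-comm x y)
        }
      }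
    ; encode = residueClass
    ; encode-cong = λ {x} {y} x≋y → toℕ-≋-injective
        (≋-trans {+ toℕ (residueClass x)} {x} (residueClass-≋ x)
          (≋-trans {x} {y} x≋y (≋-sym {+ toℕ (residueClass y)} {y} (residueClass-≋ y))))
    ; encode-injective = λ {x} {y} eq →
        ≋-trans {x} {+ toℕ (residueClass x)} (≋-sym {+ toℕ (residueClass x)} {x} (residueClass-≋ x))
          (subst (λ i → (+ toℕ i) ≋ y) (sym eq) (residueClass-≋ y))
    ; decode = λ i → + toℕ i
    ; decode-injective = toℕ-≋-injective
    }

infixr 5 _⊗_
_⊗_ : ∀ {m n} → FiniteAbelianGroup m → FiniteAbelianGroup n → FiniteAbelianGroup (m * n)
_⊗_ {m} {n} G H = record
  { abelianGroup     = DirectProduct.abelianGroup G.abelianGroup H.abelianGroup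
  ; encode           = λ (x , y) → combine (G.encode x) (H.encode y)
  ; encode-cong      = λ (eq₁ , eq₂) → cong₂ combine (G.encode-cong eq₁) (H.encode-cong eq₂)
  ; encode-injective = λ {(x , y)} {(x′ , y′)} eq → map G.encode-injective H.encode-injective
      (combine-injective (G.encode x) (H.encode y) (G.encode x′) (H.encode y′) eq)
  ; decode           = λ i → map G.decode H.decode (remQuot n i)
  ; decode-injective = λ {i} {j} (eq₁ , eq₂) → trans (sym (combine-remQuot {m} n i))
      (trans (cong₂ combine (G.decode-injective eq₁) (H.decode-injective eq₂)) (combine-remQuot {m} n j))
  }
  where
  module G = FiniteAbelianGroup G
  module H = FiniteAbelianGroup H

-- Orthogonal arrays from difference systems.

-- The rows are the (x₀ , x₁ , x₂ , t) with x₀ x₁ x₂ = ε, and the entry in column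
-- (p , i) is xₚ δₚᵢ(t). Among three columns there are either two with the same p,
-- whose quotient eliminates xₚ, or one for each p, whose product eliminates all xₚ;
-- in both cases t can be recovered.
record DifferenceSystem {n} (G : FiniteAbelianGroup n) : Set where
  open FiniteAbelianGroup G
  field
    δ                   : Fin 3 → Fin 2 → Fin n → Carrier
    products-injective  : ∀ i j k {t u} →
                          δ 0F i t ∙ (δ 1F j t ∙ δ 2F k t) ≈ δ 0F i u ∙ (δ 1F j u ∙ δ 2F k u) → t ≡ u
    quotients-injective : ∀ p {t u} → δ p 0F t - δ p 1F t ≈ δ p 0F u - δ p 1F u → t ≡ u

column : Fin 3 → Fin 2 → Fin 6
column = combine

abstract
  -- The six columns form three pairs: three distinct columns either fill one pair and meet another,
  -- or meet every pair once.
  three-columns : ∀ a b c → a ≢ b → a ≢ c → b ≢ c → let abc = a ∷ b ∷ c ∷ [] in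
    (∃[ p ] ∃[ q ] ∃[ i ] p ≢ q × column p 0F ∈ abc × column p 1F ∈ abc × column q i ∈ abc) ⊎
    (∃[ i ] ∃[ j ] ∃[ k ] column 0F i ∈ abc × column 1F j ∈ abc × column 2F k ∈ abc)
  three-columns = from-yes (all? λ a → all? λ b → all? λ c → let abc = a ∷ b ∷ c ∷ [] in
    ¬? (a ≟ b) →-dec (¬? (a ≟ c) →-dec (¬? (b ≟ c) →-dec
      ((any? λ p → any? λ q → any? λ i →
          ¬? (p ≟ q) ×-dec (column p 0F ∈? abc) ×-dec (column p 1F ∈? abc) ×-dec (column q i ∈? abc)) ⊎-dec
       (any? λ i → any? λ j → any? λ k →
          (column 0F i ∈? abc) ×-dec (column 1F j ∈? abc) ×-dec (column 2F k ∈? abc))))))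
    where open DecMembership (_≟_ {6}) using (_∈?_)

module _ {n} {G : FiniteAbelianGroup n} (D : DifferenceSystem G) where
  open FiniteAbelianGroup G hiding (refl; sym; trans; reflexive)
  open DifferenceSystem D
  open AbelianGroupProperties abelianGroup using (∙-cancelˡ; ∙-cancelʳ; ⁻¹-injective; ⁻¹-∙-comm)
  open CommutativeSemigroupProperties commutativeSemigroup using (interchange)
  private module G = FiniteAbelianGroup G

  private
    x : Triple n → Fin 3 → Carrier
    x (a , b , t) 0F = decode a
    x (a , b , t) 1F = decode b
    x (a , b , t) 2F = (decode a ∙ decode b) ⁻¹

    parameter : Triple n → Fin n
    parameter (_ , _ , t) = t

    cell : Triple n → Fin 3 × Fin 2 → Carrier
    cell R (p , i) = x R p ∙ δ p i (parameter R)

    x-product : ∀ R → x R 0F ∙ (x R 1F ∙ x R 2F) ≈ ε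
    x-product (a , b , t) = G.trans (G.sym (assoc _ _ _)) (inverseʳ _)

    cell-product : ∀ R i j k → cell R (0F , i) ∙ (cell R (1F , j) ∙ cell R (2F , k)) ≈
                   δ 0F i (parameter R) ∙ (δ 1F j (parameter R) ∙ δ 2F k (parameter R))
    cell-product R i j k =
      G.trans (∙-congˡ (interchange _ _ _ _)) (G.trans (interchange _ _ _ _) (G.trans (∙-congʳ (x-product R)) (identityˡ _)))

    cell-difference : ∀ R p → cell R (p , 0F) - cell R (p , 1F) ≈ δ p 0F (parameter R) - δ p 1F (parameter R)
    cell-difference R p =
      G.trans (∙-congˡ (G.sym (⁻¹-∙-comm _ _))) (G.trans (interchange _ _ _ _) (G.trans (∙-congʳ (inverseʳ _)) (identityˡ _)))

    -- Since x₀ x₁ x₂ = `ε`, any two of the three factors fix the remaining one.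
    x-injective : ∀ {R S p q} → p ≢ q → parameter R ≡ parameter S → x R p ≈ x S p → x R q ≈ x S q → R ≡ S
    x-injective {p = 0F} {0F} p≢q _ _ _ = contradiction refl p≢q
    x-injective {p = 1F} {1F} p≢q _ _ _ = contradiction refl p≢q
    x-injective {p = 2F} {2F} p≢q _ _ _ = contradiction refl p≢q
    x-injective {p = 0F} {1F} _ refl a b = cong₂ (λ a b → a , b , _) (decode-injective a) (decode-injective b)
    x-injective {p = 1F} {0F} _ refl b a = cong₂ (λ a b → a , b , _) (decode-injective a) (decode-injective b)
    x-injective {p = 0F} {2F} _ refl a c with refl ← decode-injective a =
      cong (λ b → _ , b , _) (decode-injective (∙-cancelˡ _ _ _ (⁻¹-injective c)))
    x-injective {p = 2F} {0F} _ refl c a with refl ← decode-injective a =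
      cong (λ b → _ , b , _) (decode-injective (∙-cancelˡ _ _ _ (⁻¹-injective c)))
    x-injective {p = 1F} {2F} _ refl b c with refl ← decode-injective b =
      cong (λ a → a , _) (decode-injective (∙-cancelʳ _ _ _ (⁻¹-injective c)))
    x-injective {p = 2F} {1F} _ refl c b with refl ← decode-injective b =
      cong (λ a → a , _) (decode-injective (∙-cancelʳ _ _ _ (⁻¹-injective c)))

    cells-separate : ∀ {R S p q i j} → p ≢ q → parameter R ≡ parameter S →
                     cell R (p , i) ≈ cell S (p , i) → cell R (q , j) ≈ cell S (q , j) → R ≡ S
    cells-separate {R} {S} p≢q t≡u p≈ q≈ = x-injective p≢q t≡u (cancel-δ t≡u p≈) (cancel-δ t≡u q≈)
      where
      cancel-δ : ∀ {R S p i} → parameter R ≡ parameter S → cell R (p , i) ≈ cell S (p , i) → x R p ≈ x S p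
      cancel-δ t≡u eq = ∙-cancelʳ _ _ _ (G.trans eq (∙-congˡ (G.reflexive (cong (δ _ _) (sym t≡u)))))

  orthogonalArray : OrthogonalArray 6 n
  orthogonalArray = record { entry = entry ; separate = separate }
    where
    entry : Triple n → Fin 6 → Fin n
    entry R c = encode (cell R (remQuot 2 c))

    separate : ∀ {a b c} → a ≢ b → a ≢ c → b ≢ c → ∀ {R S} →
               entry R a ≡ entry S a → entry R b ≡ entry S b → entry R c ≡ entry S c → R ≡ S
    separate {a} {b} {c} a≢b a≢c b≢c {R} {S} eqᵃ eqᵇ eqᶜ = by-types (three-columns a b c a≢b a≢c b≢c)
      where
      entry-agrees : ∀ {e} → e ∈ a ∷ b ∷ c ∷ [] → entry R e ≡ entry S e
      entry-agrees (here refl)                 = eqᵃ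
      entry-agrees (there (here refl))         = eqᵇ
      entry-agrees (there (there (here refl))) = eqᶜ

      agree : ∀ p i → column p i ∈ a ∷ b ∷ c ∷ [] → cell R (p , i) ≈ cell S (p , i)
      agree p i e∈ = subst (λ c → cell R c ≈ cell S c) (remQuot-combine p i) (encode-injective (entry-agrees e∈))

      by-types : _ → R ≡ S
      -- The quotient within the full pair recovers the parameter; a cell of another pair then fixes
      -- the row.
      by-types (inj₁ (p , q , i , p≢q , p₀∈ , p₁∈ , q∈)) = cells-separate p≢q
        (quotients-injective p (G.trans (G.sym (cell-difference R p))
          (G.trans (∙-cong (agree p 0F p₀∈) (⁻¹-cong (agree p 1F p₁∈))) (cell-difference S p))))
        (agree p 0F p₀∈) (agree q i q∈)
      -- The product over the three pairs recovers the parameter; two of the cells then fix the row.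
      by-types (inj₂ (i , j , k , i∈ , j∈ , k∈)) = cells-separate {p = 0F} {1F} (λ ())
        (products-injective i j k (G.trans (G.sym (cell-product R i j k))
          (G.trans (∙-cong (agree 0F i i∈) (∙-cong (agree 1F j j∈) (agree 2F k k∈))) (cell-product S i j k))))
        (agree 0F i i∈) (agree 1F j j∈)

-- Difference systems in orders prime to 6.

module _ {n} (2∤n : 2 ∤ n) (3∤n : 3 ∤ n) where
  -- A common divisor is at most 4, and each of 2, 3 and 4 would bring in a forbidden prime.
  ≤4⇒coprime : ∀ {k} → 1 ≤ k → k ≤ 4 → Coprime n k
  ≤4⇒coprime {suc _} _ k≤4 {e} (e∣n , e∣k) = divisor-one e e∣n e∣k (≤-trans (∣⇒≤ e∣k) k≤4)
    where
    divisor-one : ∀ e → e ∣ n → e ∣ suc _ → e ≤ 4 → e ≡ 1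
    divisor-one 0 _ 0∣k _ with () ← 0∣⇒≡0 0∣k
    divisor-one 1 _ _ _ = refl
    divisor-one 2 2∣n _ _ = contradiction 2∣n 2∤n
    divisor-one 3 3∣n _ _ = contradiction 3∣n 3∤n
    divisor-one 4 4∣n _ _ = contradiction (∣-trans (divides-refl 2) 4∣n) 2∤n
    divisor-one (suc (suc (suc (suc (suc _))))) _ _ (s≤s (s≤s (s≤s (s≤s ()))))

module _ {n} .{{_ : NonZero n}} (2∤n : 2 ∤ n) (3∤n : 3 ∤ n) where
  private
    -- These multipliers make every sum lie in 1, ..., 4 and every difference equal to -1, all of
    -- them units modulo an `n` prime to 6.
    κ : Fin 3 → Fin 2 → ℤ
    κ 0F 0F = + 0
    κ 0F 1F = + 1
    κ 1F 0F = + 0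
    κ 1F 1F = + 1
    κ 2F 0F = + 1
    κ 2F 1F = + 2

    Small : ℤ → Set
    Small k = 1 ≤ ℤ.∣ k ∣ × ℤ.∣ k ∣ ≤ 4

    Small? : ∀ k → Dec (Small k)
    Small? k = (1 ≤? ℤ.∣ k ∣) ×-dec (ℤ.∣ k ∣ ≤? 4)

    sums-small : ∀ i j k → Small (κ 0F i ℤ.+ (κ 1F j ℤ.+ κ 2F k))
    sums-small = from-yes (all? λ i → all? λ j → all? λ k → Small? (κ 0F i ℤ.+ (κ 1F j ℤ.+ κ 2F k)))

    differences-small : ∀ p → Small (κ p 0F ℤ.- κ p 1F)
    differences-small = from-yes (all? λ p → Small? (κ p 0F ℤ.- κ p 1F))

    open FiniteAbelianGroup (cyclic n) using (_≈_; decode-injective)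

    *-small-injective : ∀ k → Small k → ∀ {f : Fin n → ℤ} →
                        (∀ t → f t ≡ k ℤ.* + toℕ t) → ∀ {t u} → f t ≈ f u → t ≡ u
    *-small-injective k (1≤k , k≤4) f≡ {t} {u} eq = decode-injective (∣ᵤ⇒∣
      (ℤ-coprime-divisor (+ n) k _ (≤4⇒coprime 2∤n 3∤n 1≤k k≤4) (∣⇒∣ᵤ
        (subst (+ n ℤ.∣_) (trans (cong₂ ℤ._-_ (f≡ t) (f≡ u)) (lemma k (+ toℕ t) (+ toℕ u))) eq))))
      where
      lemma : ∀ k x y → k ℤ.* x ℤ.- k ℤ.* y ≡ k ℤ.* (x ℤ.- y)
      lemma = solve-∀

  coprime-system : DifferenceSystem (cyclic n)
  coprime-system = record
    { δ                   = λ p i t → κ p i ℤ.* + toℕ t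
    ; products-injective  = λ i j k → *-small-injective (κ 0F i ℤ.+ (κ 1F j ℤ.+ κ 2F k)) (sums-small i j k)
        (λ t → sum (κ 0F i) (κ 1F j) (κ 2F k) (+ toℕ t))
    ; quotients-injective = λ p → *-small-injective (κ p 0F ℤ.- κ p 1F) (differences-small p)
        (λ t → difference (κ p 0F) (κ p 1F) (+ toℕ t))
    }
    where
    sum : ∀ a b c t → a ℤ.* t ℤ.+ (b ℤ.* t ℤ.+ c ℤ.* t) ≡ (a ℤ.+ (b ℤ.+ c)) ℤ.* t
    sum = solve-∀

    difference : ∀ a b t → a ℤ.* t ℤ.- b ℤ.* t ≡ (a ℤ.- b) ℤ.* t
    difference = solve-∀

-- Difference systems verified by computation.

module _ {n} (G : FiniteAbelianGroup n) where
  open FiniteAbelianGroup G hiding (refl; sym; trans; reflexive)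

  -- The conditions survive multiplying both functions of each pair by a common function of t, if
  -- the three multipliers have product `ε`, and also reindexing t. So three of the six functions
  -- can be fixed in advance, leaving `β`, `γ₀` and `γ₁` to be found.
  normalised : (β γ₀ γ₁ : Fin n → Carrier) → Fin 3 → Fin 2 → Fin n → Carrier
  normalised β γ₀ γ₁ 0F 0F t = ε
  normalised β γ₀ γ₁ 0F 1F t = decode t
  normalised β γ₀ γ₁ 1F 0F t = ε
  normalised β γ₀ γ₁ 1F 1F t = β t
  normalised β γ₀ γ₁ 2F 0F t = γ₀ t
  normalised β γ₀ γ₁ 2F 1F t = γ₁ t

  private
    Separates : (Fin n → Carrier) → Set
    Separates f = ∀ t u → encode (f t) ≡ encode (f u) → t ≡ u

    separates? : ∀ f → Dec (Separates f)
    separates? f = all? λ t → all? λ u → (encode (f t) ≟ encode (f u)) →-dec (t ≟ u)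

    Suitable : (Fin 3 → Fin 2 → Fin n → Carrier) → Set
    Suitable δ = (∀ i j k → Separates λ t → δ 0F i t ∙ (δ 1F j t ∙ δ 2F k t)) ×
                 (∀ p → Separates λ t → δ p 0F t - δ p 1F t)

  suitable? : ∀ δ → Dec (Suitable δ)
  suitable? δ = (all? λ i → all? λ j → all? λ k → separates? _) ×-dec (all? λ p → separates? _)

  byComputation : ∀ β γ₀ γ₁ → {True (suitable? (normalised β γ₀ γ₁))} → DifferenceSystem G
  byComputation β γ₀ γ₁ {checked} = let sums , differences = toWitness checked in record
    { δ                   = normalised β γ₀ γ₁
    ; products-injective  = λ i j k eq → sums i j k _ _ (encode-cong eq)
    ; quotients-injective = λ p eq → differences p _ _ (encode-cong eq)
    }

  -- If ω is multiplication by an element of a finite field outside its prime field,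
  -- the conditions say that 1, ω, ω + 1, ω + 2 and ω + 3 are nonzero.
  fieldlike : (ω : Carrier → Carrier) →
              {True (suitable? (normalised decode (ω ∘ decode) (λ t → ω (decode t) ∙ decode t)))} → DifferenceSystem G
  fieldlike ω {checked} = byComputation decode (ω ∘ decode) (λ t → ω (decode t) ∙ decode t) {checked}

  tabulated : .{{_ : NonZero n}} → (β γ₀ γ₁ : Vec ℕ n) →
              {True (suitable? (normalised (decode ∘ (_mod n) ∘ lookup β) (decode ∘ (_mod n) ∘ lookup γ₀)
                                           (decode ∘ (_mod n) ∘ lookup γ₁)))} →
              DifferenceSystem G
  tabulated β γ₀ γ₁ {checked} = byComputation _ _ _ {checked}

-- The fields of order 4, 8, 9 and 27 below are presented by the polynomials
-- X² + X + 1, X³ + X + 1, X² + 1 and X³ − X + 1.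
abstract
  system4 : DifferenceSystem (cyclic 2 ⊗ cyclic 2)
  system4 = fieldlike _ λ (x , y) → y , x ℤ.+ y

  system8 : DifferenceSystem (cyclic 2 ⊗ cyclic 2 ⊗ cyclic 2)
  system8 = fieldlike _ λ (x , y , z) → z , x ℤ.+ z , y

  system9 : DifferenceSystem (cyclic 3 ⊗ cyclic 3)
  system9 = fieldlike _ λ (x , y) → ℤ.- y , x

  -- The tables come from a computer search; the number 6a + 3b + c codes the element (a , b , c).
  system12 : DifferenceSystem (cyclic 2 ⊗ cyclic 2 ⊗ cyclic 3)
  system12 = tabulated _
    (0 ∷ 5 ∷ 7 ∷ 3 ∷ 1 ∷ 11 ∷ 6 ∷ 10 ∷ 2 ∷ 9 ∷ 8 ∷ 4 ∷ [])
    (0 ∷ 1 ∷ 3 ∷ 8 ∷ 6 ∷ 11 ∷ 2 ∷ 5 ∷ 10 ∷ 7 ∷ 9 ∷ 4 ∷ [])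
    (0 ∷ 5 ∷ 11 ∷ 10 ∷ 7 ∷ 2 ∷ 8 ∷ 6 ∷ 9 ∷ 3 ∷ 4 ∷ 1 ∷ [])

  -- Write the elements as (u , z) with u in F₈ = F₂[α]/(α³ + α + 1) and z in ℤ/3,
  -- coded by 3u + z with u read in binary. The search was restricted to functions f = (f₁ , f₂) with
  -- f(u + 1 , z) = f(u , z) + (λ , 0) and f(u + α , − z) = (f₁(u , z) + λα , − f₂(u , z));
  -- here λ is α² + α for β, α for γ₀ and α² for γ₁.
  system24 : DifferenceSystem (cyclic 2 ⊗ cyclic 2 ⊗ cyclic 2 ⊗ cyclic 3)
  system24 = tabulated _
    (0 ∷ 19 ∷ 13 ∷ 18 ∷ 1 ∷ 7 ∷ 21 ∷ 11 ∷ 5 ∷ 3 ∷ 17 ∷ 23 ∷ 9 ∷ 2 ∷ 8 ∷ 15 ∷ 20 ∷ 14 ∷ 12 ∷ 16 ∷ 22 ∷ 6 ∷ 10 ∷ 4 ∷ [])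
    (0 ∷ 16 ∷ 7 ∷ 6 ∷ 22 ∷ 1 ∷ 12 ∷ 20 ∷ 5 ∷ 18 ∷ 14 ∷ 11 ∷ 23 ∷ 19 ∷ 9 ∷ 17 ∷ 13 ∷ 3 ∷ 10 ∷ 21 ∷ 8 ∷ 4 ∷ 15 ∷ 2 ∷ [])
    (0 ∷ 6 ∷ 17 ∷ 12 ∷ 18 ∷ 5 ∷ 9 ∷ 19 ∷ 3 ∷ 21 ∷ 7 ∷ 15 ∷ 14 ∷ 8 ∷ 23 ∷ 2 ∷ 20 ∷ 11 ∷ 22 ∷ 13 ∷ 4 ∷ 10 ∷ 1 ∷ 16 ∷ [])

  system27 : DifferenceSystem (cyclic 3 ⊗ cyclic 3 ⊗ cyclic 3)
  system27 = fieldlike _ λ (x , y , z) → ℤ.- z , x ℤ.+ z , y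

-- Arrays for powers of 2 and 3.

alternate : ∀ {c} (f : ℕ → ℕ) → OrthogonalArray 6 c → (∀ a → c * f a ≡ f (2 + a)) →
            OrthogonalArray 6 (f 0) → OrthogonalArray 6 (f 1) → ∀ a → OrthogonalArray 6 (f a)
alternate f C step F₀ F₁ 0 = F₀
alternate f C step F₀ F₁ 1 = F₁
-- In each use `c` is the square of a prime, so this step raises its exponent by two; each parity of
-- the exponent needs its own base case.
alternate f C step F₀ F₁ (suc (suc a)) = subst (OrthogonalArray 6) (step a) (C ⊠ alternate f C step F₀ F₁ a)

2^[2+a]-array : ∀ a → OrthogonalArray 6 (2 ^ (2 + a))
2^[2+a]-array = alternate (λ a → 2 ^ (2 + a)) (orthogonalArray system4) (λ a → sym (^-distribˡ-+-* 2 2 (2 + a)))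
  (orthogonalArray system4) (orthogonalArray system8)

3^[2+b]-array : ∀ b → OrthogonalArray 6 (3 ^ (2 + b))
3^[2+b]-array = alternate (λ b → 3 ^ (2 + b)) (orthogonalArray system9) (λ b → sym (^-distribˡ-+-* 3 2 (2 + b)))
  (orthogonalArray system9) (orthogonalArray system27)

2^[2+a]*3-array : ∀ a → OrthogonalArray 6 (2 ^ (2 + a) * 3)
2^[2+a]*3-array = alternate (λ a → 2 ^ (2 + a) * 3) (orthogonalArray system4)
  (λ a → trans (sym (*-assoc 4 (2 ^ (2 + a)) 3)) (cong (_* 3) (sym (^-distribˡ-+-* 2 2 (2 + a)))))
  (orthogonalArray system12) (orthogonalArray system24)

-- Factorisation of the order and the gcd conditions.

factorOut : ∀ p → .{{NonTrivial p}} → ∀ n → .{{NonZero n}} → ∃[ a ] ∃[ m ] n ≡ p ^ a * m × p ∤ m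
factorOut p n = <-rec (λ n → .{{NonZero n}} → ∃[ a ] ∃[ m ] n ≡ p ^ a * m × p ∤ m) step n
  where
  step : ∀ n → (∀ {k} → k < n → .{{NonZero k}} → ∃[ a ] ∃[ m ] k ≡ p ^ a * m × p ∤ m) →
         .{{NonZero n}} → ∃[ a ] ∃[ m ] n ≡ p ^ a * m × p ∤ m
  step n rec with p ∣? n
  ... | no  p∤n = 0 , n , sym (*-identityˡ n) , p∤n
  ... | yes p∣n@(divides q n≡q*p) with a , m , q≡ , p∤m ← rec (quotient-< p∣n) {{quotient≢0 p∣n}} =
    suc a , m , trans n≡q*p (trans (*-comm q p) (trans (cong (p *_) q≡) (sym (*-assoc p (p ^ a) m)))) , p∤m

-- gcd(2u, 4) = 2 gcd(u, 2). This rules out exponent 1 for the prime 2.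
odd⇒gcd≡2 : ∀ {u} → 2 ∤ u → gcd (2 * u) 4 ≡ 2
odd⇒gcd≡2 {u} 2∤u = trans (sym (c*gcd[m,n]≡gcd[cm,cn] 2 u 2)) (cong (2 *_) (coprime⇒gcd≡1 coprime))
  where
  coprime : Coprime u 2
  coprime {0} (_ , 0∣2) with () ← 0∣⇒≡0 0∣2
  coprime {1} _ = refl
  coprime {2} (2∣u , _) = contradiction 2∣u 2∤u
  coprime {suc (suc (suc _))} (_ , e∣2) with s≤s (s≤s ()) ← ∣⇒≤ e∣2

-- gcd(3w, 18) = 3 gcd(w, 6). This rules out exponent 1 for the prime 3 in odd orders.
coprime-6⇒gcd≡3 : ∀ {w} → 2 ∤ w → 3 ∤ w → gcd (3 * w) 18 ≡ 3
coprime-6⇒gcd≡3 {w} 2∤w 3∤w = trans (sym (c*gcd[m,n]≡gcd[cm,cn] 3 w 6)) (cong (3 *_) (coprime⇒gcd≡1 coprime))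
  where
  coprime : Coprime w 6
  -- Dividing the odd number w, e is prime to 2, so e ∣ 6 gives e ∣ 3.
  coprime {e} (e∣w , e∣6) = ≤4⇒coprime 2∤w 3∤w (s≤s z≤n) (s≤s (s≤s (s≤s z≤n))) (e∣w , coprime-divisor e⊥2 e∣6)
    where
    e⊥2 : Coprime e 2
    e⊥2 (f∣e , f∣2) = ≤4⇒coprime 2∤w 3∤w (s≤s z≤n) (s≤s (s≤s z≤n)) (∣-trans f∣e e∣w , f∣2)

orthogonalArray6 : ∀ v → .{{NonZero v}} → gcd v 4 ≢ 2 → gcd v 18 ≢ 3 → OrthogonalArray 6 v
orthogonalArray6 v 4-condition 18-condition
  with a , u , refl , 2∤u ← factorOut 2 v
  with b , w , refl , 3∤w ← factorOut 3 u {{m*n≢0⇒n≢0 (2 ^ a)}} = assemble a b 2∤u 4-condition 18-condition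
  where
  2∤w : 2 ∤ w
  2∤w = 2∤u ∘ ∣n⇒∣m*n (3 ^ b)

  instance
    w≢0 : NonZero w
    w≢0 = m*n≢0⇒n≢0 (3 ^ b) {{m*n≢0⇒n≢0 (2 ^ a)}}

  w-array : OrthogonalArray 6 w
  w-array = orthogonalArray (coprime-system 2∤w 3∤w)

  -- The gcd conditions exclude a = 1 and (a , b) = (0 , 1). For a ≥ 2 and b = 1 the lone factor 3
  -- is absorbed into the power of 2 through orders 12 and 24; otherwise the prime powers are
  -- treated separately.
  assemble : ∀ a b → 2 ∤ 3 ^ b * w → gcd (2 ^ a * (3 ^ b * w)) 4 ≢ 2 → gcd (2 ^ a * (3 ^ b * w)) 18 ≢ 3 →
             OrthogonalArray 6 (2 ^ a * (3 ^ b * w))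
  assemble 0 0 _ _ _ = subst (OrthogonalArray 6) (sym (trans (*-identityˡ _) (*-identityˡ w))) w-array
  assemble 0 1 _ _ 18-condition =
    contradiction (trans (cong (λ m → gcd m 18) (*-identityˡ (3 * w))) (coprime-6⇒gcd≡3 2∤w 3∤w)) 18-condition
  assemble 0 (suc (suc b)) _ _ _ = subst (OrthogonalArray 6) (sym (*-identityˡ _)) (3^[2+b]-array b ⊠ w-array)
  assemble 1 b odd 4-condition _ = contradiction (odd⇒gcd≡2 odd) 4-condition
  assemble (suc (suc a)) 0 _ _ _ =
    subst (OrthogonalArray 6) (cong (2 ^ (2 + a) *_) (sym (*-identityˡ w))) (2^[2+a]-array a ⊠ w-array)
  assemble (suc (suc a)) 1 _ _ _ =
    subst (OrthogonalArray 6) (*-assoc (2 ^ (2 + a)) 3 w) (2^[2+a]*3-array a ⊠ w-array)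
  assemble (suc (suc a)) (suc (suc b)) _ _ _ = 2^[2+a]-array a ⊠ (3^[2+b]-array b ⊠ w-array)

mainTheorem11 : (v : ℕ) → 2 ≤ v → gcd v 4 ≢ 2 → gcd v 18 ≢ 3 →
    (d : ℕ) → 1 ≤ d → d + 1 ≤ v →
    Σ (CDA d 2 ((d + 1) * v ^ 2) 11 v) Optimum
mainTheorem11 v 2≤v 4-condition 18-condition d _ d+1≤v = FromOrthogonalArray.cda array d+1≤v , refl
  where array = orthogonalArray6 v {{>-nonZero (≤-trans (s≤s z≤n) 2≤v)}} 4-condition 18-condition
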